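{- Let $n\ge 6$ and let $L$ be a 3-uniform list assignment of $\Pi_n$. If $c$ is a lex-min $L$-coloring of $\Pi_n$, then $c$ is $\lceil 2n/3\rceil$-bounded, i.e. every color class of $c$ has at most $\lceil 2n/3\rceil$ vertices.
   Context: $\Pi_n=C_n\square K_2$ has vertices $u_1,\dots,u_n,v_1,\dots,v_n$ and edges $u_iu_{i+1}$, $v_iv_{i+1}$ (indices mod $n$) and $u_iv_i$. A 3-uniform list assignment gives each vertex a set $L(v)$ of exactly 3 colors; a proper $L$-coloring is a proper coloring with $c(v)\in L(v)$. For a proper $L$-coloring $c$ with nonempty color classes $C_1,\dots,C_r$ ordered so that $|C_1|\ge\cdots\ge|C_r|$, the color word is $w_c=n_1\cdots n_r$ with $n_i=|C_i|$. A lex-min $L$-coloring is a proper $L$-coloring $c$ such that for every proper $L$-coloring $c'$ with color word $m_1\cdots m_s$, either $w_c=w_{c'}$ or there is $k$ ($1\le k\le s$) with $n_i=m_i$ for $i<k$ and $n_k<m_k$. -}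

module Defs where

open import Data.Nat using (ℕ; zero; suc; _+_; _*_; _≤_; _<_; _/_)
open import Data.Nat.Properties using (≤-decTotalOrder)
import Data.Nat as ℕ
open import Data.Fin using (Fin; toℕ)
open import Data.Fin.Properties using () renaming (_≟_ to _≟ᶠ_)
open import Data.Product using (_×_; _,_; ∃)
open import Data.Sum using (_⊎_)
open import Data.List using (List; []; _∷_; length; map; filter; reverse; deduplicate; cartesianProduct; allFin)
open import Data.List.Relation.Unary.Unique.Propositional using (Unique)
open import Data.List.Membership.Propositional using (_∈_)
open import Data.List.Sort ≤-decTotalOrder using (sort)
open import Relation.Binary.PropositionalEquality using (_≡_; _≢_)
open import Relation.Nullary using (¬_)

-- Vertices of the prism Π_n = C_n □ K_2:
-- (0 , i) is u_{i+1} and (1 , i) is v_{i+1}  (0-based index i : Fin n).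
Vertex : ℕ → Set
Vertex n = Fin 2 × Fin n

allVertices : (n : ℕ) → List (Vertex n)
allVertices n = cartesianProduct (allFin 2) (allFin n)

CycSucc : {n : ℕ} → Fin n → Fin n → Set
CycSucc {n} i j = (suc (toℕ i) ≡ toℕ j) ⊎ (suc (toℕ i) ≡ n × toℕ j ≡ 0)

Adj : {n : ℕ} → Vertex n → Vertex n → Set
Adj (s , i) (t , j) =
  (s ≡ t × (CycSucc i j ⊎ CycSucc j i)) ⊎ (i ≡ j × s ≢ t)

ListAssignment : ℕ → Set
ListAssignment n = Vertex n → List ℕ

ThreeUniform : {n : ℕ} → ListAssignment n → Set
ThreeUniform {n} L = (v : Vertex n) → length (L v) ≡ 3 × Unique (L v)

Coloring : ℕ → Set
Coloring n = Vertex n → ℕ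

ProperLColoring : {n : ℕ} → ListAssignment n → Coloring n → Set
ProperLColoring {n} L c =
  ((v : Vertex n) → c v ∈ L v) × ((v w : Vertex n) → Adj v w → c v ≢ c w)

classSize : {n : ℕ} → Coloring n → ℕ → ℕ
classSize {n} c x = length (filter (λ v → c v ℕ.≟ x) (allVertices n))

usedColors : {n : ℕ} → Coloring n → List ℕ
usedColors {n} c = deduplicate ℕ._≟_ (map c (allVertices n))

colorWord : {n : ℕ} → Coloring n → List ℕ
colorWord c = reverse (sort (map (classSize c) (usedColors c)))

data LexLt : List ℕ → List ℕ → Set where
  here  : ∀ {a b as bs} → a < b → LexLt (a ∷ as) (b ∷ bs)
  there : ∀ {a as bs} → LexLt as bs → LexLt (a ∷ as) (a ∷ bs)

LexMin : {n : ℕ} → ListAssignment n → Coloring n → Set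
LexMin {n} L c =
  ProperLColoring L c ×
  ((c' : Coloring n) → ProperLColoring L c' →
     colorWord c ≡ colorWord c' ⊎ LexLt (colorWord c) (colorWord c'))

ceil3 : ℕ → ℕ
ceil3 a = (a + 2) / 3

Bounded : {n : ℕ} → ℕ → Coloring n → Set
Bounded b c = (x : ℕ) → classSize c x ≤ b

{-# OPTIONS --safe #-}
-- The first letter of the color word is the size of the largest class, so it suffices to exhibit one
-- proper L-coloring with all classes of size at most ⌈2n/3⌉, and for that a partition of the vertices
-- into at most ⌈2n/3⌉ groups whose members get distinct colors.
--
-- If along one of the two cycles some list contains a color γ missing from the preceding list, unroll
-- the prism into a ladder x₀ … xₙ₋₁, y₀ … yₙ₋₁ with γ ∈ L(x₀) ∖ L(xₙ₋₁), and put c(x₀) = γ.  In the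
-- order y₀, x₀, y₁, x₁, … the groups are triples of consecutive vertices, only the first one being
-- possibly shorter.  All but the last three columns are colored greedily, avoiding the two preceding
-- colors.  In the last three columns xₙ₋₁ may ignore x₀; one of two candidate colors for xₙ₋₃ always
-- leads to a completion.
--
-- Otherwise each of the two cycles has three colors common to all of its lists.  These two triples are
-- matched so that shared colors correspond, and an explicit 3-coloring of the prism is used.
module Submission where

open import Defs
open import Data.Nat
open import Data.Nat.Properties
open import Data.Nat.DivMod
open import Data.Nat.Solver using (module +-*-Solver)
open import Data.Fin using (Fin; toℕ; opposite) renaming (zero to fzero; suc to fsuc)
open import Data.Fin.Properties using (toℕ-fromℕ<; toℕ<n; toℕ-injective; opposite-involutive)
open import Data.Product using (_×_; _,_; ∃; ∃₂; proj₁; proj₂)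
open import Data.Sum using (_⊎_; inj₁; inj₂; [_,_]′)
open import Data.List using (List; []; _∷_; length; map; filter; reverse; allFin; upTo)
open import Data.List.Properties using (length-map; length-upTo; filter-notAll; unfold-reverse; filter-none)
open import Data.List.Membership.Propositional using (_∈_; _∉_; find)
open import Data.List.Membership.Propositional.Properties
open import Data.List.Membership.DecPropositional _≟_ using (_∈?_)
open import Data.List.Relation.Unary.Any as Any using (here; there; any?)
open import Data.List.Relation.Unary.All as All using (All; []; _∷_; all?)
open import Data.List.Relation.Unary.All.Properties using (all-filter; ¬All⇒Any¬; ¬Any⇒All¬)
open import Data.List.Relation.Unary.AllPairs using (AllPairs; []; _∷_)
import Data.List.Relation.Unary.AllPairs.Properties as AllPairsₚ
open import Data.List.Relation.Unary.Unique.Propositional using (Unique)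
import Data.List.Relation.Unary.Unique.Propositional.Properties as Uniqueₚ
open import Data.List.Relation.Binary.Permutation.Propositional using (↭-trans; ↭-sym)
open import Data.List.Relation.Binary.Permutation.Propositional.Properties
  using (↭-reverse; All-resp-↭; ∈-resp-↭)
open import Data.List.Sort ≤-decTotalOrder using (sort-↭; sort-↗)
open import Data.List.Relation.Unary.Sorted.TotalOrder.Properties using (Sorted⇒AllPairs)
open import Function using (_∘_; id; flip)
open import Relation.Binary.PropositionalEquality
open import Relation.Nullary using (¬_; yes; no; ¬?; contradiction)
open import Relation.Nullary.Decidable using (decidable-stable)

-- Color words and lexicographic comparison

AllPairs-reverse : ∀ {R : ℕ → ℕ → Set} {xs} → AllPairs R xs → AllPairs (flip R) (reverse xs)
AllPairs-reverse [] = []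
AllPairs-reverse {R} {x ∷ xs} (rx ∷ rxs) rewrite unfold-reverse x xs =
  AllPairsₚ.++⁺ (AllPairs-reverse rxs) ([] ∷ [])
    (All.map (_∷ []) (All-resp-↭ (↭-sym (↭-reverse xs)) rx))

classSize-∈-colorWord : ∀ {n} (c : Coloring n) v → classSize c (c v) ∈ colorWord c
classSize-∈-colorWord {n} c (s , i) =
  ∈-resp-↭ (↭-sym (↭-trans (↭-reverse _) (sort-↭ _)))
    (∈-map⁺ (classSize c)
      (∈-deduplicate⁺ _≟_
        (∈-map⁺ c (∈-cartesianProduct⁺ (∈-allFin s) (∈-allFin i)))))

colorWord-bounded : ∀ {n m} (c : Coloring n) → Bounded m c → All (_≤ m) (colorWord c)
colorWord-bounded c bnd =
  All-resp-↭ (↭-sym (↭-trans (↭-reverse _) (sort-↭ _))) (All.tabulate bound)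
  where
  bound : ∀ {k} → k ∈ map (classSize c) (usedColors c) → k ≤ _
  bound k∈ with ∈-map⁻ (classSize c) k∈
  ... | x , _ , refl = bnd x

colorWord-descending : ∀ {n} (c : Coloring n) → AllPairs _≥_ (colorWord c)
colorWord-descending c =
  AllPairs-reverse (Sorted⇒AllPairs ≤-totalOrder (sort-↗ (map (classSize c) (usedColors c))))

-- A descending word is bounded by its head, so the comparison of the heads decides: whether `as`
-- drops at the head or agrees there with `bs`, its head is at most `m`.
word-bounded-by-lex : ∀ {m as bs} → AllPairs _≥_ as → as ≡ bs ⊎ LexLt as bs →
                      All (_≤ m) bs → All (_≤ m) as
word-bounded-by-lex _ (inj₁ refl) bs≤m = bs≤m
word-bounded-by-lex (a≥ ∷ _) (inj₂ (LexLt.here a<b)) (b≤m ∷ _) =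
  let a≤m = ≤-trans (<⇒≤ a<b) b≤m in a≤m ∷ All.map (λ x≤a → ≤-trans x≤a a≤m) a≥
word-bounded-by-lex (a≥ ∷ _) (inj₂ (LexLt.there _)) (a≤m ∷ _) =
  a≤m ∷ All.map (λ x≤a → ≤-trans x≤a a≤m) a≥

classSize-unused : ∀ {n} (c : Coloring n) x → All (λ v → c v ≢ x) (allVertices n) → classSize c x ≡ 0
classSize-unused c x none = cong length (filter-none (λ v → c v ≟ x) none)

lexMin-bounded : ∀ {n m} {L : ListAssignment n} {c c' : Coloring n} →
                 LexMin L c → ProperLColoring L c' → Bounded m c' → Bounded m c
lexMin-bounded {n} {m} {L} {c} {c'} (_ , min) proper bnd x
  with any? (λ v → c v ≟ x) (allVertices n)
... | no  none = subst (_≤ m) (sym (classSize-unused c x (¬Any⇒All¬ _ none))) z≤n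
... | yes used with Any.satisfied used
...   | v , refl = All.lookup
  (word-bounded-by-lex (colorWord-descending c) (min c' proper) (colorWord-bounded c' bnd))
  (classSize-∈-colorWord c v)

-- Counting with duplicate-free lists

AllPairs-upgrade : ∀ {A : Set} {R S : A → A → Set} {P : A → Set} →
  (∀ {x y} → R x y → P x → P y → S x y) →
  ∀ {xs} → AllPairs R xs → All P xs → AllPairs S xs
AllPairs-upgrade up [] [] = []
AllPairs-upgrade up (rx ∷ rxs) (px ∷ pxs) =
  All.zipWith (λ (r , p) → up r px p) (rx , pxs) ∷ AllPairs-upgrade up rxs pxs

infixl 6 _∖_
_∖_ : List ℕ → ℕ → List ℕ
xs ∖ x = filter (λ y → ¬? (y ≟ x)) xs

∈-∖⁺ : ∀ {xs x y} → y ∈ xs → y ≢ x → y ∈ xs ∖ x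
∈-∖⁺ {x = x} = ∈-filter⁺ (λ y → ¬? (y ≟ x))

∈-∖⁻ : ∀ {xs x y} → y ∈ xs ∖ x → y ∈ xs × y ≢ x
∈-∖⁻ {x = x} = ∈-filter⁻ (λ y → ¬? (y ≟ x))

length-∖ : ∀ {xs x} → x ∈ xs → length (xs ∖ x) < length xs
length-∖ {xs} {x} x∈xs = filter-notAll (λ y → ¬? (y ≟ x)) xs (Any.map (λ { refl neq → neq refl }) x∈xs)

-- Pigeonhole by induction: the head of `xs` is deleted from `ys`, and the rest of `xs` still fits
-- because it does not repeat the head.
unique-⊆-length : ∀ {xs ys} → Unique xs → (∀ {x} → x ∈ xs → x ∈ ys) → length xs ≤ length ys
unique-⊆-length [] _ = z≤n
unique-⊆-length (x∉ ∷ u) ⊆ys =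
  ≤-trans (s≤s (unique-⊆-length u λ y∈ → ∈-∖⁺ (⊆ys (there y∈)) (≢-sym (All.lookup x∉ y∈))))
          (length-∖ (⊆ys (here refl)))

⊆-or-escape : ∀ xs ys → (∀ {x} → x ∈ xs → x ∈ ys) ⊎ ∃ λ x → x ∈ xs × x ∉ ys
⊆-or-escape xs ys with all? (_∈? ys) xs
... | yes all = inj₁ (All.lookup all)
... | no ¬all with find (¬All⇒Any¬ (_∈? ys) xs ¬all)
...   | x , x∈ , x∉ = inj₂ (x , x∈ , x∉)

escape : ∀ {xs} → Unique xs → ∀ ys → length ys < length xs → ∃ λ x → x ∈ xs × x ∉ ys
escape {xs} u ys lt with ⊆-or-escape xs ys
... | inj₁ ⊆ys = contradiction (unique-⊆-length u ⊆ys) (<⇒≱ lt)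
... | inj₂ esc = esc

-- A color class meets each group at most once, so `g` is injective on it and embeds it into the
-- numbers below `m`.
rainbow-bounded : ∀ {n m} (c : Coloring n) (g : Vertex n → ℕ) → (∀ v → g v < m) →
                  (∀ {v w} → v ≢ w → g v ≡ g w → c v ≢ c w) → Bounded m c
rainbow-bounded {n} {m} c g g<m rainbow x = begin
  classSize c x                       ≡⟨ sym (length-map g class) ⟩
  length (map g class)                ≤⟨ unique-⊆-length distinct inRange ⟩
  length (upTo m)                     ≡⟨ length-upTo m ⟩
  m                                   ∎
  where
  open ≤-Reasoning
  class : List (Vertex n)
  class = filter (λ v → c v ≟ x) (allVertices n)
  distinct : Unique (map g class)
  distinct = AllPairsₚ.map⁺ (AllPairs-upgrade
    (λ v≢w cv cw gv≡gw → rainbow v≢w gv≡gw (trans cv (sym cw)))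
    (Uniqueₚ.filter⁺ (λ v → c v ≟ x) (Uniqueₚ.cartesianProduct⁺ (Uniqueₚ.allFin⁺ 2) (Uniqueₚ.allFin⁺ n)))
    (all-filter (λ v → c v ≟ x) (allVertices n)))
  inRange : ∀ {k} → k ∈ map g class → k ∈ upTo m
  inRange k∈ with ∈-map⁻ g k∈
  ... | v , _ , refl = ∈-upTo⁺ (g<m v)

-- Rotations of the cycle

[m%n+o]%n≡[m+o]%n : ∀ m o n .{{_ : NonZero n}} → (m % n + o) % n ≡ (m + o) % n
[m%n+o]%n≡[m+o]%n m o n = begin
  (m % n + o) % n           ≡⟨ %-distribˡ-+ (m % n) o n ⟩
  (m % n % n + o % n) % n   ≡⟨ cong (λ k → (k + o % n) % n) (m%n%n≡m%n m n) ⟩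
  (m % n + o % n) % n       ≡⟨ sym (%-distribˡ-+ m o n) ⟩
  (m + o) % n               ∎
  where open ≡-Reasoning

suc-% : ∀ m n → (suc m % suc n ≡ suc (m % suc n) × suc (m % suc n) < suc n)
              ⊎ (m % suc n ≡ n × suc m % suc n ≡ 0)
suc-% m n with suc (m % suc n) <? suc n | %-step
  where
  %-step : suc (m % suc n) % suc n ≡ suc m % suc n
  %-step = trans (cong (_% suc n) (+-comm 1 (m % suc n)))
          (trans ([m%n+o]%n≡[m+o]%n m 1 (suc n)) (cong (_% suc n) (+-comm m 1)))
... | yes lt | step = inj₁ (trans (sym step) (m<n⇒m%n≡m lt) , lt)
... | no ¬lt | step = inj₂ (m%n≡n , trans (sym step) (trans (cong (λ k → suc k % suc n) m%n≡n) (n%n≡0 (suc n))))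
  where
  m%n≡n : m % suc n ≡ n
  m%n≡n = ≤-antisym (s≤s⁻¹ (m%n<n m (suc n))) (s≤s⁻¹ (≮⇒≥ ¬lt))

module Rotation (n shift : ℕ) where

  column : ℕ → Fin (suc n)
  column k = (k + shift) mod suc n

  -- Since `n` is -1 modulo `suc n`, adding `n * shift` undoes the shift of `column` without any
  -- truncated subtraction.
  index : Fin (suc n) → ℕ
  index i = (toℕ i + n * shift) % suc n

  index<n : ∀ i → index i < suc n
  index<n i = m%n<n (toℕ i + n * shift) (suc n)

  column∘index : ∀ i → column (index i) ≡ i
  column∘index i = toℕ-injective (begin
    toℕ (column (index i))                            ≡⟨ toℕ-fromℕ< _ ⟩
    (index i + shift) % suc n                         ≡⟨ [m%n+o]%n≡[m+o]%n (toℕ i + n * shift) shift (suc n) ⟩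
    (toℕ i + n * shift + shift) % suc n               ≡⟨ cong (_% suc n) (solve 3 (λ a b c →
                                                           a :+ b :* c :+ c := a :+ c :* (con 1 :+ b)) refl (toℕ i) n shift) ⟩
    (toℕ i + shift * suc n) % suc n                   ≡⟨ [m+kn]%n≡m%n (toℕ i) shift (suc n) ⟩
    toℕ i % suc n                                     ≡⟨ m<n⇒m%n≡m (toℕ<n i) ⟩
    toℕ i                                             ∎)
    where
    open ≡-Reasoning
    open +-*-Solver

  index-injective : ∀ {i j} → index i ≡ index j → i ≡ j
  index-injective eq = trans (sym (column∘index _)) (trans (cong column eq) (column∘index _))

  index-cycSucc : ∀ {i j} → CycSucc i j →
    (index j ≡ suc (index i) × suc (index i) < suc n) ⊎ (index i ≡ n × index j ≡ 0)
  index-cycSucc {i} {j} i→j =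
    subst (λ k → (k ≡ suc (index i) × suc (index i) < suc n) ⊎ (index i ≡ n × k ≡ 0))
          (sym (step i→j)) (suc-% (toℕ i + n * shift) n)
    where
    step : CycSucc i j → index j ≡ suc (toℕ i + n * shift) % suc n
    step (inj₁ eq) = cong (λ k → (k + n * shift) % suc n) (sym eq)
    -- The wraparound edge: `toℕ j`, which is 0, and `suc (toℕ i)`, which is `suc n`, agree modulo
    -- `suc n`.
    step (inj₂ (i≡n , j≡0)) = begin
      (toℕ j + n * shift) % suc n        ≡⟨ cong (λ k → (k + n * shift) % suc n) j≡0 ⟩
      (n * shift) % suc n                ≡⟨ sym ([m+n]%n≡m%n (n * shift) (suc n)) ⟩
      (n * shift + suc n) % suc n        ≡⟨ cong (_% suc n) (+-comm (n * shift) (suc n)) ⟩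
      (suc n + n * shift) % suc n        ≡⟨ cong (λ k → (k + n * shift) % suc n) (sym i≡n) ⟩
      suc (toℕ i + n * shift) % suc n    ∎
      where open ≡-Reasoning

-- Ladder colorings and groups of three consecutive vertices

Lists : Set
Lists = Fin 2 → ℕ → List ℕ

LadderColoring : Set
LadderColoring = Fin 2 → ℕ → ℕ

-- In the order f 0 0, f 1 0, f 0 1, f 1 1, … any three consecutive vertices get distinct colors,
-- except possibly where the three straddle the boundary between the columns before and from N on.
record RainbowLadder (n N : ℕ) (K : Lists) (f : LadderColoring) : Set where
  field
    inList : ∀ b {c} → c < n → f b c ∈ K b c
    rung   : ∀ {c} → c < n → f fzero c ≢ f (fsuc fzero) c
    rail   : ∀ b {c} → suc c < n → f b c ≢ f b (suc c)
    cross  : ∀ {c} → suc c < n → suc c ≢ N → f (fsuc fzero) c ≢ f fzero (suc c)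

  rung-≢ : ∀ {a b c} → a ≢ b → c < n → f a c ≢ f b c
  rung-≢ {fzero}      {fzero}      a≢b _  = contradiction refl a≢b
  rung-≢ {fzero}      {fsuc fzero} _   lt = rung lt
  rung-≢ {fsuc fzero} {fzero}      _   lt = ≢-sym (rung lt)
  rung-≢ {fsuc fzero} {fsuc fzero} a≢b _  = contradiction refl a≢b

3+m≤n⇒m/3≢n/3 : ∀ {m n} → 3 + m ≤ n → m / 3 ≢ n / 3
3+m≤n⇒m/3≢n/3 {m} {n} le eq = 1+n≰n (begin
  suc (m / 3)   ≡⟨ sym (m/n≡1+[m∸n]/n {3 + m} {3} (m≤m+n 3 m)) ⟩
  (3 + m) / 3   ≤⟨ /-monoˡ-≤ 3 le ⟩
  n / 3         ≡⟨ sym eq ⟩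
  m / 3         ∎)
  where open ≤-Reasoning

module Groups (offset : ℕ) where

  -- `2 * c + toℕ b` is the place of the vertex in the ladder order, which is cut into blocks of
  -- three; an `offset` of 1 or 2 shortens the first block by that much.
  group : Fin 2 → ℕ → ℕ
  group b c = (2 * c + toℕ b + offset) / 3

  far : ∀ a b c k → 3 + (2 * c + toℕ a) ≤ 2 * (k + c) + toℕ b → group a c ≢ group b (k + c)
  far a b c k le = 3+m≤n⇒m/3≢n/3 (+-monoˡ-≤ offset le)

  -- The divisibility makes a group start at column `suc c`. Hence the one pair exempt from `cross`
  -- never shares a group.
  group-boundary : ∀ {M} c → 2 * suc c + offset ≡ M * 3 → group (fsuc fzero) c ≢ group fzero (suc c)
  group-boundary {M} c eq same = <⇒≢ (m<n*o⇒m/o<n {n = M} before) (trans same after)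
    where
    open +-*-Solver
    before : 2 * c + 1 + offset < M * 3
    before = ≤-reflexive (trans (solve 2 (λ x o →
      con 1 :+ (con 2 :* x :+ con 1 :+ o) := con 2 :* (con 1 :+ x) :+ o) refl c offset) eq)
    after : group fzero (suc c) ≡ M
    after = trans (cong (_/ 3) (trans (cong (_+ offset) (+-identityʳ (2 * suc c))) eq)) (m*n/n≡m M 3)

  module _ {n N K f M} (R : RainbowLadder n N K f) (2N+o≡3M : 2 * N + offset ≡ M * 3) where
    open RainbowLadder R

    -- Members of one group are at most two places apart, so distinct ones form a rung, a rail or a
    -- cross pair; every other pair is at least three places apart and excluded by `far`.
    rainbow-ahead : ∀ a b c k → (k ≡ 0 → a ≢ b) → k + c < n →
                    group a c ≡ group b (k + c) → f a c ≢ f b (k + c)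
    rainbow-ahead a b c zero a≢b lt _ = rung-≢ (a≢b refl) lt
    rainbow-ahead fzero fzero c 1 _ lt _ = rail fzero lt
    rainbow-ahead (fsuc fzero) (fsuc fzero) c 1 _ lt _ = rail (fsuc fzero) lt
    rainbow-ahead fzero (fsuc fzero) c 1 _ _ same =
      contradiction same (far fzero (fsuc fzero) c 1 (≤-reflexive
        (solve 1 (λ x → con 3 :+ (con 2 :* x :+ con 0) := con 2 :* (con 1 :+ x) :+ con 1) refl c)))
      where open +-*-Solver
    rainbow-ahead (fsuc fzero) fzero c 1 _ lt same with suc c ≟ N
    ... | yes refl = contradiction same (group-boundary {M} c 2N+o≡3M)
    ... | no  c≢N  = cross lt c≢N
    rainbow-ahead a b c (suc (suc k)) _ _ same = contradiction same (far a b c (2 + k) (begin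
      3 + (2 * c + toℕ a)          ≤⟨ +-monoʳ-≤ 3 (+-monoʳ-≤ (2 * c) (s≤s⁻¹ (toℕ<n a))) ⟩
      3 + (2 * c + 1)              ≤⟨ m≤m+n _ (2 * k + toℕ b) ⟩
      3 + (2 * c + 1) + (2 * k + toℕ b)
        ≡⟨ solve 3 (λ x y z → con 3 :+ (con 2 :* x :+ con 1) :+ (con 2 :* y :+ z)
                         := con 2 :* (con 2 :+ y :+ x) :+ z) refl c k (toℕ b) ⟩
      2 * (2 + k + c) + toℕ b      ∎))
      where
      open ≤-Reasoning
      open +-*-Solver

    rainbow : ∀ a b {c d} → (c ≡ d → a ≢ b) → c < n → d < n →
              group a c ≡ group b d → f a c ≢ f b d
    rainbow a b {c} {d} a≢b c<n d<n same eq with ≤-total c d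
    ... | inj₁ c≤d with d ∸ c | m∸n+n≡m c≤d
    ...   | k | refl = rainbow-ahead a b c k (λ { refl → a≢b refl }) d<n same eq
    rainbow a b {c} {d} a≢b c<n d<n same eq | inj₂ d≤c with c ∸ d | m∸n+n≡m d≤c
    ...   | k | refl = rainbow-ahead b a d k (λ { refl → ≢-sym (a≢b refl) }) c<n (sym same) (sym eq)

-- The offset pads `k` to the next multiple of 3; its value is read off from the division of `k + 2`
-- by 3.
ceil3-offset : ∀ k → ∃ λ offset → k + offset ≡ ceil3 k * 3
ceil3-offset k = 2 ∸ (k + 2) % 3 , +-cancelʳ-≡ ((k + 2) % 3) _ _ (begin
  k + (2 ∸ (k + 2) % 3) + (k + 2) % 3     ≡⟨ +-assoc k _ _ ⟩
  k + (2 ∸ (k + 2) % 3 + (k + 2) % 3)     ≡⟨ cong (k +_) (m∸n+n≡m (s≤s⁻¹ (m%n<n (k + 2) 3))) ⟩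
  k + 2                                   ≡⟨ m≡m%n+[m/n]*n (k + 2) 3 ⟩
  (k + 2) % 3 + ceil3 k * 3               ≡⟨ +-comm ((k + 2) % 3) _ ⟩
  ceil3 k * 3 + (k + 2) % 3               ∎)
  where open ≡-Reasoning

-- From a ladder back to the prism

module Transfer {n : ℕ} (L : ListAssignment (suc n)) (shift : ℕ)
                (τ σ : Fin 2 → Fin 2) (τ∘σ : ∀ t → τ (σ t) ≡ t) where
  open Rotation n shift

  unrolled : Lists
  unrolled b k = L (τ b , column k)

  -- The groups do not wrap around, so the seam only asks that the two closing rail edges be proper.
  -- `boundary` makes a group start at column `N`, and `fits` keeps the group numbers below the
  -- bound.
  close-up : ∀ {N f offset M} → RainbowLadder (suc n) N unrolled f → (∀ b → f b n ≢ f b 0) →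
             2 * N + offset ≡ M * 3 → 2 * suc n + offset ≤ ceil3 (2 * suc n) * 3 →
             ∃ λ c → ProperLColoring L c × Bounded (ceil3 (2 * suc n)) c
  close-up {N} {f} {offset} {M} R close boundary fits =
    c , ((λ (t , i) → colored t i) , proper) , rainbow-bounded c g g<m g-rainbow
    where
    open RainbowLadder R
    open Groups offset
    c : Coloring (suc n)
    c (t , i) = f (σ t) (index i)

    colored : ∀ t i → c (t , i) ∈ L (t , i)
    colored t i = subst₂ (λ s j → c (t , i) ∈ L (s , j)) (τ∘σ t) (column∘index i)
                         (inList (σ t) (index<n i))

    σ-injective : ∀ {s t} → σ s ≡ σ t → s ≡ t
    σ-injective eq = trans (sym (τ∘σ _)) (trans (cong τ eq) (τ∘σ _))

    along : ∀ b {i j} → CycSucc i j → f b (index i) ≢ f b (index j)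
    along b i→j eq with index-cycSucc i→j
    ... | inj₁ (j≡ , lt)  = rail b lt (trans eq (cong (f b) j≡))
    ... | inj₂ (i≡ , j≡)  = close b (trans (sym (cong (f b) i≡)) (trans eq (cong (f b) j≡)))

    proper : ∀ v w → Adj v w → c v ≢ c w
    proper (s , i) (t , j) (inj₁ (refl , inj₁ i→j)) = along (σ s) i→j
    proper (s , i) (t , j) (inj₁ (refl , inj₂ j→i)) = ≢-sym (along (σ s) j→i)
    proper (s , i) (t , j) (inj₂ (refl , s≢t))      = rung-≢ (s≢t ∘ σ-injective) (index<n i)

    g : Vertex (suc n) → ℕ
    g (t , i) = group (σ t) (index i)

    g<m : ∀ v → g v < ceil3 (2 * suc n)
    g<m (t , i) = m<n*o⇒m/o<n {n = ceil3 (2 * suc n)} (begin-strict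
      2 * index i + toℕ (σ t) + offset   <⟨ +-monoˡ-< offset (+-monoʳ-< (2 * index i) (toℕ<n (σ t))) ⟩
      2 * index i + 2 + offset           ≡⟨ cong (_+ offset) (solve 1 (λ x →
                                              con 2 :* x :+ con 2 := con 2 :* (con 1 :+ x)) refl (index i)) ⟩
      2 * suc (index i) + offset         ≤⟨ +-monoˡ-≤ offset (*-monoʳ-≤ 2 (index<n i)) ⟩
      2 * suc n + offset                 ≤⟨ fits ⟩
      ceil3 (2 * suc n) * 3              ∎)
      where
      open ≤-Reasoning
      open +-*-Solver

    g-rainbow : ∀ {v w} → v ≢ w → g v ≡ g w → c v ≢ c w
    g-rainbow {s , i} {t , j} v≢w =
      rainbow {M = M} R boundary (σ s) (σ t)
        (λ i≡j s≡t → v≢w (cong₂ _,_ (σ-injective s≡t) (index-injective i≡j)))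
        (index<n i) (index<n j)

-- Gluing two ladders

join : ℕ → (ℕ → ℕ) → (ℕ → ℕ) → ℕ → ℕ
join zero    pre post k       = post k
join (suc N) pre post zero    = pre zero
join (suc N) pre post (suc k) = join N (pre ∘ suc) post k

join-pre : ∀ {N pre post k} → k < N → join N pre post k ≡ pre k
join-pre {suc N} {k = zero}  _  = refl
join-pre {suc N} {pre} {k = suc k} lt = join-pre {N} {pre ∘ suc} (s≤s⁻¹ lt)

join-post : ∀ N {pre post} k → join N pre post (N + k) ≡ post k
join-post zero    k = refl
join-post (suc N) {pre} k = join-post N {pre ∘ suc} k

data SplitAt (N r : ℕ) : ℕ → Set where
  before : ∀ {k} → k < N → SplitAt N r k
  after  : ∀ {k} → k < r → SplitAt N r (N + k)

splitAt : ∀ N r {k} → k < N + r → SplitAt N r k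
splitAt N r {k} lt with k <? N
... | yes k<N = before k<N
... | no  k≮N with k ∸ N | m+[n∸m]≡n (≮⇒≥ k≮N)
...   | j | refl = after (+-cancelˡ-< N j r lt)

-- The parameter 0 exempts nothing, as no `suc c` equals 0, so both parts are fully rainbow. The
-- result is exempt at column `suc M`, which leaves only the two rail edges to check at the joint.
glue : ∀ {M r K pre post} →
       RainbowLadder (suc M) 0 K pre → RainbowLadder (suc r) 0 (λ b k → K b (suc M + k)) post →
       (∀ b → pre b M ≢ post b 0) →
       RainbowLadder (suc M + suc r) (suc M) K (λ b → join (suc M) (pre b) (post b))
glue {M} {r} {K} {pre} {post} A B joint = record
  { inList = inList ; rung = rung ; rail = rail ; cross = cross }
  where
  module A = RainbowLadder A
  module B = RainbowLadder B
  f : LadderColoring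
  f b = join (suc M) (pre b) (post b)

  f-pre : ∀ b {k} → k < suc M → pre b k ≡ f b k
  f-pre b lt = sym (join-pre {pre = pre b} lt)
  f-post : ∀ b k → post b k ≡ f b (suc M + k)
  f-post b k = sym (join-post (suc M) {pre b} k)
  f-post-suc : ∀ b k → post b (suc k) ≡ f b (suc (suc M + k))
  f-post-suc b k = trans (f-post b (suc k)) (cong (f b) (cong suc (+-suc M k)))

  inList : ∀ b {c} → c < suc M + suc r → f b c ∈ K b c
  inList b lt with splitAt (suc M) (suc r) lt
  ... | before l     = subst (_∈ K b _) (f-pre b l) (A.inList b l)
  ... | after {k} l  = subst (_∈ K b _) (f-post b k) (B.inList b l)

  rung : ∀ {c} → c < suc M + suc r → f fzero c ≢ f (fsuc fzero) c
  rung lt with splitAt (suc M) (suc r) lt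
  ... | before l    = subst₂ _≢_ (f-pre _ l) (f-pre _ l) (A.rung l)
  ... | after {k} l = subst₂ _≢_ (f-post _ k) (f-post _ k) (B.rung l)

  -- Shared by `rail` and `cross`: a pair in neighboring columns lies in the first part, across the
  -- joint, or in the second part.
  step : ∀ a b {c} → suc c < suc M + suc r →
         (suc c < suc M → pre a c ≢ pre b (suc c)) →
         (suc c ≡ suc M → f a c ≢ f b (suc c)) →
         (∀ {k} → suc k < suc r → post a k ≢ post b (suc k)) →
         f a c ≢ f b (suc c)
  step a b {c} lt inPre atJoint inPost with splitAt (suc M) (suc r) (<⇒≤ lt)
  ... | after {k} l = subst₂ _≢_ (f-post a k) (f-post-suc b k)
                        (inPost (+-cancelˡ-< (suc M) (suc k) (suc r)
                          (subst (_< suc M + suc r) (sym (cong suc (+-suc M k))) lt)))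
  ... | before l with suc c ≟ suc M
  ...   | yes eq = atJoint eq
  ...   | no neq = subst₂ _≢_ (f-pre a l) (f-pre b l') (inPre l')
    where
    l' : suc c < suc M
    l' = ≤∧≢⇒< l neq

  rail : ∀ b {c} → suc c < suc M + suc r → f b c ≢ f b (suc c)
  rail b lt = step b b lt (A.rail b)
    (λ { refl → subst₂ _≢_ (f-pre b (n<1+n M)) (trans (f-post b 0) (cong (f b) (+-identityʳ (suc M)))) (joint b) })
    (B.rail b)

  cross : ∀ {c} → suc c < suc M + suc r → suc c ≢ suc M → f (fsuc fzero) c ≢ f fzero (suc c)
  cross lt c≢M = step (fsuc fzero) fzero lt (λ l → A.cross l λ ()) (λ eq → contradiction eq c≢M)
                      (λ l → B.cross l λ ())

glue-close-up : ∀ {M r offset G} (L : ListAssignment (suc (M + suc r))) shift τ σ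
  (τ∘σ : ∀ t → τ (σ t) ≡ t) {pre post} → let K = Transfer.unrolled L shift τ σ τ∘σ in
  RainbowLadder (suc M) 0 K pre → RainbowLadder (suc r) 0 (λ b k → K b (suc M + k)) post →
  (∀ b → pre b M ≢ post b 0) → (∀ b → post b r ≢ pre b 0) →
  2 * suc M + offset ≡ G * 3 →
  2 * (suc M + suc r) + offset ≤ ceil3 (2 * (suc M + suc r)) * 3 →
  ∃ λ c → ProperLColoring L c × Bounded (ceil3 (2 * (suc M + suc r))) c
glue-close-up {M} {r} {offset} {G} L shift τ σ τ∘σ {pre} {post} A B joint close =
  Transfer.close-up L shift τ σ τ∘σ {M = G} (glue A B joint)
    -- At column 0 the joined coloring computes to `pre b 0`, so only the last column needs
    -- rewriting.
    (λ b → subst (_≢ pre b 0) (last b) (close b))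
  where
  last : ∀ b → post b r ≡ join (suc M) (pre b) (post b) (M + suc r)
  last b = trans (sym (join-post (suc M) {pre b} r)) (cong (join (suc M) (pre b) (post b)) (sym (+-suc M r)))

-- Three colors common to all lists of each cycle

-- The residue modulo 3, with recursion in steps of three so that `cyc (3 + k)` computes to `cyc k`.
cyc : ℕ → Fin 3
cyc 0                   = fzero
cyc 1                   = fsuc fzero
cyc 2                   = fsuc (fsuc fzero)
cyc (suc (suc (suc k))) = cyc k

cyc-≢₁ : ∀ k → cyc k ≢ cyc (1 + k)
cyc-≢₁ 0 ()
cyc-≢₁ 1 ()
cyc-≢₁ 2 ()
cyc-≢₁ (suc (suc (suc k))) = cyc-≢₁ k

cyc-≢₂ : ∀ k → cyc k ≢ cyc (2 + k)
cyc-≢₂ 0 ()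
cyc-≢₂ 1 ()
cyc-≢₂ 2 ()
cyc-≢₂ (suc (suc (suc k))) = cyc-≢₂ k

-- The place in the ladder order modulo 3, with phase `s`.
stripe : ℕ → Fin 2 → ℕ → Fin 3
stripe s b k = cyc (toℕ b + k * 2 + s)

-- This combines injectivity on each side with equal indices for a color shared by both sides, so
-- that distinct indices always give distinct colors.
Aligned : ∀ {m} → (Fin 2 → Fin m → ℕ) → Set
Aligned ψ = ∀ {a b k l} → ψ a k ≡ ψ b l → k ≡ l

-- Rungs and cross pairs are one place apart and rails two, so the residues modulo 3 differ, and by
-- alignment the colors do.
stripe-ladder : ∀ {ψ : Fin 2 → Fin 3 → ℕ} {K} r s → Aligned ψ → (∀ b j k → ψ b j ∈ K b k) →
                 RainbowLadder r 0 K (λ b k → ψ b (stripe s b k))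
stripe-ladder {ψ} r s aligned ψ∈ = record
  { inList = λ b {c} _ → ψ∈ b _ c
  ; rung   = λ {c} _ eq → cyc-≢₁ (c * 2 + s) (aligned eq)
  ; rail   = λ { fzero {c} _ eq → cyc-≢₂ (c * 2 + s) (aligned eq)
               ; (fsuc fzero) {c} _ eq → cyc-≢₂ (1 + c * 2 + s) (aligned eq) }
  ; cross  = λ {c} _ _ eq → cyc-≢₁ (1 + c * 2 + s) (aligned eq)
  }

-- Three columns are six places, a multiple of 3.
stripe-last : ∀ q b → stripe 0 b (2 + q * 3) ≡ stripe 0 b 2
stripe-last zero    b            = refl
stripe-last (suc q) fzero        = stripe-last q fzero
stripe-last (suc q) (fsuc fzero) = stripe-last q (fsuc fzero)

-- The stripes close up around the cycle only if 3 ∣ n (here r = 2); otherwise the last r + 1 columns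
-- carry the stripes shifted by 2.
stripe-shift : ∀ r → r < 3 → ∃ λ s →
  (∀ b → stripe 0 b 2 ≢ stripe s b 0) × (∀ b → stripe s b r ≢ stripe 0 b 0)
stripe-shift 0 _ = 2 , (λ { fzero () ; (fsuc fzero) () }) , (λ { fzero () ; (fsuc fzero) () })
stripe-shift 1 _ = 2 , (λ { fzero () ; (fsuc fzero) () }) , (λ { fzero () ; (fsuc fzero) () })
stripe-shift 2 _ = 0 , (λ { fzero () ; (fsuc fzero) () }) , (λ { fzero () ; (fsuc fzero) () })
stripe-shift (suc (suc (suc _))) (s≤s (s≤s (s≤s ())))

stripe-colorable : ∀ q r → r < 3 → (L : ListAssignment (3 + q * 3 + suc r)) →
  ∀ {ψ : Fin 2 → Fin 3 → ℕ} → Aligned ψ → (∀ b j i → ψ b j ∈ L (b , i)) →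
  ∃ λ c → ProperLColoring L c × Bounded (ceil3 (2 * (3 + q * 3 + suc r))) c
stripe-colorable q r r<3 L {ψ} aligned ψ∈ with stripe-shift r r<3
-- The first part has `3 * suc q` columns, that is exactly `2 * suc q` full groups, so with offset 0
-- a group starts at the joint.
... | s , joint , close = glue-close-up {offset = 0} {G = 2 * suc q} L 0 id id (λ _ → refl)
  (stripe-ladder _ 0 aligned λ b j k → ψ∈ b j _)
  (stripe-ladder _ s aligned λ b j k → ψ∈ b j _)
  (λ b eq → joint b (trans (sym (stripe-last q b)) (aligned eq)))
  (λ b eq → close b (aligned eq))
  (trans (+-identityʳ _) (sym (*-assoc 2 (suc q) 3)))
  (subst₂ _≤_ (sym (+-identityʳ _)) (proj₂ (ceil3-offset n2)) (m≤m+n n2 _))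
  where
  n2 : ℕ
  n2 = 2 * (3 + q * 3 + suc r)

-- Matching the shared colors of two lists

length-∖-≥ : ∀ {xs m} x → Unique xs → suc m ≤ length xs → m ≤ length (xs ∖ x)
length-∖-≥ {xs} x u le = s≤s⁻¹ (≤-trans le (unique-⊆-length u keep))
  where
  keep : ∀ {y} → y ∈ xs → y ∈ x ∷ (xs ∖ x)
  keep {y} y∈ with y ≟ x
  ... | yes y≡x = here y≡x
  ... | no  y≢x = there (∈-∖⁺ y∈ y≢x)

-- A common color, if there is one, serves as head on both sides; otherwise the lists are disjoint
-- and any two heads will do.
aligned-heads : (S : Fin 2 → List ℕ) → (∀ b → Unique (S b)) → (∀ b → 0 < length (S b)) →
  ∃ λ (h : Fin 2 → ℕ) → (∀ b → h b ∈ S b) × (∀ a b → h a ∉ S b ∖ h b)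
aligned-heads S u pos with any? (_∈? S (fsuc fzero)) (S fzero)
... | yes common with find common
...   | x , x∈₀ , x∈₁ = (λ _ → x) , (λ { fzero → x∈₀ ; (fsuc fzero) → x∈₁ }) ,
                        λ a b x∈ → proj₂ (∈-∖⁻ {S b} x∈) refl
aligned-heads S u pos | no disjoint = h , h∈ , h∉
  where
  h : Fin 2 → ℕ
  h b = proj₁ (escape (u b) [] (pos b))
  h∈ : ∀ b → h b ∈ S b
  h∈ b = proj₁ (proj₂ (escape (u b) [] (pos b)))
  h∉ : ∀ a b → h a ∉ S b ∖ h b
  h∉ fzero        fzero        ∈S = proj₂ (∈-∖⁻ {S fzero} ∈S) refl
  h∉ fzero        (fsuc fzero) ∈S = All.lookup (¬Any⇒All¬ _ disjoint) (h∈ fzero) (proj₁ (∈-∖⁻ ∈S))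
  h∉ (fsuc fzero) fzero        ∈S = All.lookup (¬Any⇒All¬ _ disjoint) (proj₁ (∈-∖⁻ ∈S)) (h∈ (fsuc fzero))
  h∉ (fsuc fzero) (fsuc fzero) ∈S = proj₂ (∈-∖⁻ {S (fsuc fzero)} ∈S) refl

-- Heads are split off repeatedly. As no head survives in either remainder, index 0 shares no color
-- with a later index.
align : ∀ m (S : Fin 2 → List ℕ) → (∀ b → Unique (S b)) → (∀ b → m ≤ length (S b)) →
        ∃ λ (ψ : Fin 2 → Fin m → ℕ) → (∀ b k → ψ b k ∈ S b) × Aligned ψ
align zero    S u len = (λ _ ()) , (λ _ ()) , λ { {k = ()} }
align (suc m) S u len with aligned-heads S u (λ b → ≤-trans (s≤s z≤n) (len b))
... | h , h∈ , h∉ with align m (λ b → S b ∖ h b) (λ b → Uniqueₚ.filter⁺ _ (u b))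
                             (λ b → length-∖-≥ (h b) (u b) (len b))
...   | ψ , ψ∈ , aligned = ψ⁺ , ψ⁺∈ , aligned⁺
  where
  ψ⁺ : Fin 2 → Fin (suc m) → ℕ
  ψ⁺ b fzero    = h b
  ψ⁺ b (fsuc k) = ψ b k
  ψ⁺∈ : ∀ b k → ψ⁺ b k ∈ S b
  ψ⁺∈ b fzero    = h∈ b
  ψ⁺∈ b (fsuc k) = proj₁ (∈-∖⁻ (ψ∈ b k))
  aligned⁺ : Aligned ψ⁺
  aligned⁺         {k = fzero}  {fzero}  eq = refl
  aligned⁺ {a} {b} {k = fzero}  {fsuc l} eq = contradiction (subst (_∈ S b ∖ h b) (sym eq) (ψ∈ b l)) (h∉ a b)
  aligned⁺ {a} {b} {k = fsuc k} {fzero}  eq = contradiction (subst (_∈ S a ∖ h a) eq (ψ∈ a k)) (h∉ b a)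
  aligned⁺         {k = fsuc k} {fsuc l} eq = cong fsuc (aligned eq)

-- Lists that vary along a cycle

Three : List ℕ → Set
Three xs = length xs ≡ 3 × Unique xs

avoid₂ : ∀ {xs} → Three xs → ∀ a b → ∃ λ x → x ∈ xs × x ≢ a × x ≢ b
avoid₂ (len , u) a b with escape u (a ∷ b ∷ []) (≤-reflexive (sym len))
... | x , x∈ , x∉ = x , x∈ , (λ eq → x∉ (here eq)) , (λ eq → x∉ (there (here eq)))

three-⊈-pair : ∀ {xs a b} → Three xs → ¬ (∀ {x} → x ∈ xs → x ∈ a ∷ b ∷ [])
three-⊈-pair (len , u) sub with subst (_≤ 2) len (unique-⊆-length u sub)
... | s≤s (s≤s ())

-- If `y` were missing, the three entries of `xs` would all lie in `ys ∖ y`, which has fewer than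
-- three.
three-⊆-reverse : ∀ {xs ys} → Three xs → length ys ≡ 3 → (∀ {x} → x ∈ xs → x ∈ ys) →
                  ∀ {y} → y ∈ ys → y ∈ xs
three-⊆-reverse {xs} {ys} (len , u) len′ sub {y} y∈ = decidable-stable (y ∈? xs) λ y∉ →
  <-irrefl (trans len (sym len′))
    (≤-<-trans (unique-⊆-length u λ x∈ → ∈-∖⁺ (sub x∈) λ { refl → y∉ x∈ }) (length-∖ y∈))

-- Side `fsuc fzero` is the x side. Its first vertex is fixed to γ and y₀ avoids γ; every later
-- vertex has three colors and avoids its two predecessors in the order.
greedy-ladder : ∀ {K} → (∀ b k → Three (K b k)) → ∀ {γ} → γ ∈ K (fsuc fzero) 0 → ∀ n →
  ∃ λ f → RainbowLadder n 0 K f × f (fsuc fzero) 0 ≡ γ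
greedy-ladder {K} three {γ} γ∈ n = f , record
  { inList = λ { fzero {zero} _ → proj₁ (proj₂ first)
               ; fzero {suc c} _ → proj₁ (proj₂ (low c))
               ; (fsuc fzero) {zero} _ → γ∈
               ; (fsuc fzero) {suc c} _ → proj₁ (proj₂ (high c)) }
  ; rung   = λ { {zero} _ → proj₁ (proj₂ (proj₂ first))
               ; {suc c} _ → ≢-sym (proj₂ (proj₂ (proj₂ (high c)))) }
  ; rail   = λ { fzero {c} _ → ≢-sym (proj₁ (proj₂ (proj₂ (low c))))
               ; (fsuc fzero) {c} _ → ≢-sym (proj₁ (proj₂ (proj₂ (high c)))) }
  ; cross  = λ {c} _ _ → ≢-sym (proj₂ (proj₂ (proj₂ (low c))))
  } , refl
  where
  first : ∃ λ x → x ∈ K fzero 0 × x ≢ γ × x ≢ γ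
  first = avoid₂ (three fzero 0) γ γ
  f : LadderColoring
  f fzero        zero    = proj₁ first
  f fzero        (suc k) = proj₁ (avoid₂ (three fzero (suc k)) (f fzero k) (f (fsuc fzero) k))
  f (fsuc fzero) zero    = γ
  -- The inner `avoid₂` is the value of `f fzero (suc k)` written out, so that each recursive call
  -- is at column `k`.
  f (fsuc fzero) (suc k) = proj₁ (avoid₂ (three (fsuc fzero) (suc k)) (f (fsuc fzero) k)
                             (proj₁ (avoid₂ (three fzero (suc k)) (f fzero k) (f (fsuc fzero) k))))
  low : ∀ k → ∃ λ y → y ∈ K fzero (suc k) × y ≢ f fzero k × y ≢ f (fsuc fzero) k
  low k = avoid₂ (three fzero (suc k)) (f fzero k) (f (fsuc fzero) k)
  high : ∀ k → ∃ λ x → x ∈ K (fsuc fzero) (suc k) × x ≢ f (fsuc fzero) k × x ≢ f fzero (suc k)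
  high k = avoid₂ (three (fsuc fzero) (suc k)) (f (fsuc fzero) k) (f fzero (suc k))

-- `G`, `H`, `D`, `Q`, `P` are the lists of xₙ₋₃, yₙ₋₃, yₙ₋₂, xₙ₋₂, yₙ₋₁. The colors already fixed
-- are `x′` and `y′` in column n-4 and `e` at y₀. The vertex xₙ₋₁ is left for `closing-ladder`.
module Closing {G H D Q P : List ℕ}
  (three-G : Three G) (three-H : Three H) (three-D : Three D) (three-Q : Three Q) (three-P : Three P)
  (x′ y′ e : ℕ) where

  record Completion (g : ℕ) : Set where
    field
      h d q p : ℕ
      h∈ : h ∈ H
      d∈ : d ∈ D
      q∈ : q ∈ Q
      p∈ : p ∈ P
      h≢y′ : h ≢ y′
      h≢g : h ≢ g
      d≢g : d ≢ g
      d≢h : d ≢ h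
      q≢g : q ≢ g
      q≢d : q ≢ d
      p≢e : p ≢ e
      p≢d : p ≢ d
      p≢q : p ≢ q

  -- The obstruction: with this `d`, both xₙ₋₂ and yₙ₋₁ are forced to the same color `p`.
  record Stuck (g : ℕ) : Set where
    field
      d p : ℕ
      d≢g : d ≢ g
      Q⊆  : ∀ {x} → x ∈ Q → x ∈ g ∷ d ∷ p ∷ []
      P⊆  : ∀ {x} → x ∈ P → x ∈ e ∷ d ∷ p ∷ []

  -- After choosing h, d and p, a color of `Q` outside g, d, p finishes. Otherwise q has to be p,
  -- and yₙ₋₁ is recolored from `P` outside e, d, p if possible. If both attempts fail, `g` is
  -- stuck.
  complete : ∀ g → Completion g ⊎ Stuck g
  complete g
    with h , h∈ , h≢y′ , h≢g ← avoid₂ three-H y′ g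
    with d , d∈ , d≢g , d≢h ← avoid₂ three-D g h
    with p , p∈ , p≢e , p≢d ← avoid₂ three-P e d
    with ⊆-or-escape Q (g ∷ d ∷ p ∷ [])
  ... | inj₂ (q , q∈ , q∉) = inj₁ record
    { h∈ = h∈ ; d∈ = d∈ ; q∈ = q∈ ; p∈ = p∈ ; h≢y′ = h≢y′ ; h≢g = h≢g ; d≢g = d≢g ; d≢h = d≢h
    ; q≢g = λ eq → q∉ (here eq) ; q≢d = λ eq → q∉ (there (here eq)) ; p≢e = p≢e ; p≢d = p≢d
    ; p≢q = λ eq → q∉ (there (there (here (sym eq)))) }
  ... | inj₁ Q⊆ with ⊆-or-escape P (e ∷ d ∷ p ∷ []) | avoid₂ three-Q g d
  ...   | inj₁ P⊆ | _ = inj₂ record { d≢g = d≢g ; Q⊆ = Q⊆ ; P⊆ = P⊆ }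
  ...   | inj₂ (p₂ , p₂∈ , p₂∉) | q , q∈ , q≢g , q≢d = inj₁ record
    { h∈ = h∈ ; d∈ = d∈ ; q∈ = q∈ ; p∈ = p₂∈ ; h≢y′ = h≢y′ ; h≢g = h≢g ; d≢g = d≢g ; d≢h = d≢h
    ; q≢g = q≢g ; q≢d = q≢d ; p≢e = λ eq → p₂∉ (here eq) ; p≢d = λ eq → p₂∉ (there (here eq))
    ; p≢q = λ p₂≡q → p₂∉ (there (there (here (trans p₂≡q (q≡p (Q⊆ q∈)))))) }
    where
    q≡p : q ∈ g ∷ d ∷ p ∷ [] → q ≡ p
    q≡p (here eq)                 = contradiction eq q≢g
    q≡p (there (here eq))         = contradiction eq q≢d
    q≡p (there (there (here eq))) = eq

  -- Being stuck forces Q = {g, d, p} and P = {e, d, p}. If g₁ ≢ g₂ then g₁ lies in {d₂, p₂} ⊆ P,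
  -- so g₁ = e by the description of P through d₁ and p₁; but e ∉ {d₂, p₂}.
  stuck-unique : ∀ {g₁ g₂} → Stuck g₁ → Stuck g₂ → g₁ ≡ g₂
  stuck-unique {g₁} {g₂} S₁ S₂ = locate (S₂.Q⊆ (three-⊆-reverse three-Q refl S₁.Q⊆ (here refl)))
    where
    module S₁ = Stuck S₁
    module S₂ = Stuck S₂
    g₁≢p₁ : g₁ ≢ S₁.p
    g₁≢p₁ refl = three-⊈-pair three-Q λ x∈ → drop (S₁.Q⊆ x∈)
      where
      drop : ∀ {x a b} → x ∈ a ∷ b ∷ a ∷ [] → x ∈ a ∷ b ∷ []
      drop (here eq)                 = here eq
      drop (there (here eq))         = there (here eq)
      drop (there (there (here eq))) = here eq
    g₁∈P⇒g₁≡e : g₁ ∈ P → g₁ ≡ e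
    g₁∈P⇒g₁≡e g₁∈ with S₁.P⊆ g₁∈
    ... | here eq                 = eq
    ... | there (here eq)         = contradiction (sym eq) S₁.d≢g
    ... | there (there (here eq)) = contradiction eq g₁≢p₁
    e∉d₂p₂ : e ∉ S₂.d ∷ S₂.p ∷ []
    e∉d₂p₂ e∈ = three-⊈-pair three-P λ x∈ → drop (S₂.P⊆ x∈)
      where
      drop : ∀ {x} → x ∈ e ∷ S₂.d ∷ S₂.p ∷ [] → x ∈ S₂.d ∷ S₂.p ∷ []
      drop (here refl) = e∈
      drop (there x∈)  = x∈
    locate : g₁ ∈ g₂ ∷ S₂.d ∷ S₂.p ∷ [] → g₁ ≡ g₂
    locate (here eq)   = eq
    locate (there g₁∈) = contradiction
      (subst (_∈ _) (g₁∈P⇒g₁≡e (three-⊆-reverse three-P refl S₂.P⊆ (there g₁∈))) g₁∈) e∉d₂p₂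

  -- `G` has two colors other than `x′`, and by `stuck-unique` at most one of them is stuck.
  completion : ∃ λ g → g ∈ G × g ≢ x′ × Completion g
  completion =
    let g₁ , g₁∈ , g₁≢x′ , _     = avoid₂ three-G x′ x′
        g₂ , g₂∈ , g₂≢x′ , g₂≢g₁ = avoid₂ three-G x′ g₁
    in [ (λ C₁ → g₁ , g₁∈ , g₁≢x′ , C₁)
       , (λ S₁ → [ (λ C₂ → g₂ , g₂∈ , g₂≢x′ , C₂)
                 , (λ S₂ → contradiction (stuck-unique S₂ S₁) g₂≢g₁) ]′ (complete g₂)) ]′ (complete g₁)

-- The last vertex xₙ₋₁ has to avoid q and p only: it differs from the γ at x₀ because γ is not in
-- its list.
closing-ladder : ∀ {K} → (∀ b k → Three (K b k)) → ∀ x′ y′ e {γ} → γ ∉ K (fsuc fzero) 2 →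
  ∃ λ f → RainbowLadder 3 0 K f × f fzero 0 ≢ y′ × f (fsuc fzero) 0 ≢ x′ ×
          f fzero 2 ≢ e × f (fsuc fzero) 2 ≢ γ
closing-ladder {K} three x′ y′ e {γ} γ∉ =
  let g , g∈ , g≢x′ , C = completion
      u , u∈ , u≢q , u≢p = avoid₂ (three (fsuc fzero) 2) (Completion.q C) (Completion.p C)
  in assemble g g∈ g≢x′ C u u∈ u≢q u≢p
  where
  open Closing (three (fsuc fzero) 0) (three fzero 0) (three fzero 1) (three (fsuc fzero) 1)
               (three fzero 2) x′ y′ e
  assemble : ∀ g → g ∈ K (fsuc fzero) 0 → g ≢ x′ → (C : Completion g) →
    ∀ u → u ∈ K (fsuc fzero) 2 → u ≢ Completion.q C → u ≢ Completion.p C →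
    ∃ λ f → RainbowLadder 3 0 K f × f fzero 0 ≢ y′ × f (fsuc fzero) 0 ≢ x′ ×
            f fzero 2 ≢ e × f (fsuc fzero) 2 ≢ γ
  assemble g g∈ g≢x′ C u u∈ u≢q u≢p =
    f , record { inList = inList ; rung = rung ; rail = rail ; cross = cross }
    , h≢y′ , g≢x′ , p≢e , λ { refl → γ∉ u∈ }
    where
    open Completion C
    f : LadderColoring
    f fzero        0             = h
    f fzero        1             = d
    f fzero        (suc (suc _)) = p
    f (fsuc fzero) 0             = g
    f (fsuc fzero) 1             = q
    f (fsuc fzero) (suc (suc _)) = u
    inList : ∀ b {c} → c < 3 → f b c ∈ K b c
    inList fzero        {0} _ = h∈
    inList fzero        {1} _ = d∈
    inList fzero        {2} _ = p∈
    inList (fsuc fzero) {0} _ = g∈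
    inList (fsuc fzero) {1} _ = q∈
    inList (fsuc fzero) {2} _ = u∈
    inList _ {suc (suc (suc _))} (s≤s (s≤s (s≤s ())))
    rung : ∀ {c} → c < 3 → f fzero c ≢ f (fsuc fzero) c
    rung {0} _ = h≢g
    rung {1} _ = ≢-sym q≢d
    rung {2} _ = ≢-sym u≢p
    rung {suc (suc (suc _))} (s≤s (s≤s (s≤s ())))
    rail : ∀ b {c} → suc c < 3 → f b c ≢ f b (suc c)
    rail fzero        {0} _ = ≢-sym d≢h
    rail fzero        {1} _ = ≢-sym p≢d
    rail (fsuc fzero) {0} _ = ≢-sym q≢g
    rail (fsuc fzero) {1} _ = ≢-sym u≢q
    rail _ {suc (suc _)} (s≤s (s≤s (s≤s ())))
    cross : ∀ {c} → suc c < 3 → suc c ≢ 0 → f (fsuc fzero) c ≢ f fzero (suc c)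
    cross {0} _ _ = ≢-sym d≢g
    cross {1} _ _ = ≢-sym p≢q
    cross {suc (suc _)} (s≤s (s≤s (s≤s ()))) _

differing-lists : ∀ {M} (L : ListAssignment (suc M + 3)) → ThreeUniform L →
  ∀ shift τ σ (τ∘σ : ∀ t → τ (σ t) ≡ t) → let K = Transfer.unrolled L shift τ σ τ∘σ in
  ∀ {γ} → γ ∈ K (fsuc fzero) 0 → γ ∉ K (fsuc fzero) (suc M + 2) →
  ∃ λ c → ProperLColoring L c × Bounded (ceil3 (2 * (suc M + 3))) c
differing-lists {M} L uniform shift τ σ τ∘σ {γ} γ∈ γ∉ =
  let pre , A , start = greedy-ladder (λ b k → uniform _) γ∈ (suc M)
      post , B , h≢y′ , g≢x′ , p≢e , u≢γ =
        closing-ladder (λ b k → uniform _) (pre (fsuc fzero) M) (pre fzero M) (pre fzero 0) γ∉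
      offset , eq = ceil3-offset (2 * (suc M + 3))
  -- The last three columns are six places, hence exactly the last two groups; this is the 2
  -- subtracted from the number of groups.
  in glue-close-up {G = ceil3 (2 * (suc M + 3)) ∸ 2} L shift τ σ τ∘σ A B
      (λ { fzero → ≢-sym h≢y′ ; (fsuc fzero) → ≢-sym g≢x′ })
      (λ { fzero → p≢e ; (fsuc fzero) u≡x₀ → u≢γ (trans u≡x₀ start) })
      (boundary offset (ceil3 (2 * (suc M + 3))) eq)
      (≤-reflexive eq)
  where
  open +-*-Solver
  boundary : ∀ o m → 2 * (suc M + 3) + o ≡ m * 3 → 2 * suc M + o ≡ (m ∸ 2) * 3
  boundary o m eq = sym (trans (*-distribʳ-∸ 3 m 2) (trans (cong (_∸ 6) (trans (sym eq)
    (solve 2 (λ x y → con 2 :* (x :+ con 3) :+ y := con 2 :* x :+ y :+ con 6) refl (suc M) o)))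
    (m+n∸n≡m _ 6)))

-- Case distinction on the lists

-- If no list up to `A r` gains a color over its predecessor, the inclusions chain from `A r` down
-- to every earlier list.
first-escape : ∀ (A : ℕ → List ℕ) r →
  (∃₂ λ k x → x ∈ A (suc k) × x ∉ A k) ⊎ (∀ k x → k ≤ r → x ∈ A r → x ∈ A k)
first-escape A zero = inj₂ λ { _ _ z≤n x∈ → x∈ }
first-escape A (suc r) with first-escape A r | ⊆-or-escape (A (suc r)) (A r)
... | inj₁ esc  | _                    = inj₁ esc
... | inj₂ _    | inj₂ (x , x∈ , x∉)   = inj₁ (r , x , x∈ , x∉)
... | inj₂ desc | inj₁ sub             = inj₂ descend
  where
  descend : ∀ k x → k ≤ suc r → x ∈ A (suc r) → x ∈ A k
  descend k x k≤ x∈ with k ≟ suc r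
  ... | yes refl = x∈
  ... | no  k≢   = desc k x (s≤s⁻¹ (≤∧≢⇒< k≤ k≢)) (sub x∈)

toℕ-mod : ∀ {n} (i : Fin (suc n)) → toℕ i mod suc n ≡ i
toℕ-mod i = toℕ-injective (trans (toℕ-fromℕ< _) (m<n⇒m%n≡m (toℕ<n i)))

EquitablyColorable : ∀ {n} → ListAssignment n → Set
EquitablyColorable {n} L = ∃ λ c → ProperLColoring L c × Bounded (ceil3 (2 * n)) c

-- Rotating by `suc k` puts the list with the new color into column 0 and its predecessor into the
-- last column.
escape-colorable : ∀ {M} (L : ListAssignment (suc M + 3)) → ThreeUniform L → ∀ t k {γ} →
  γ ∈ L (t , suc k mod (suc M + 3)) → γ ∉ L (t , k mod (suc M + 3)) → EquitablyColorable L
escape-colorable {M} L uniform t k {γ} γ∈ γ∉ = orient t γ∈ (subst (λ i → γ ∉ L (t , i)) wrap γ∉)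
  where
  open +-*-Solver
  wrap : k mod (suc M + 3) ≡ Rotation.column (M + 3) (suc k) (suc M + 2)
  wrap = toℕ-injective (trans (toℕ-fromℕ< _) (trans (sym ([m+n]%n≡m%n k (suc M + 3)))
    (trans (cong (_% (suc M + 3)) (solve 2 (λ x y →
      x :+ (con 1 :+ y :+ con 3) := con 1 :+ y :+ con 2 :+ (con 1 :+ x)) refl k M))
      (sym (toℕ-fromℕ< _)))))
  orient : ∀ t → γ ∈ L (t , suc k mod (suc M + 3)) →
           γ ∉ L (t , Rotation.column (M + 3) (suc k) (suc M + 2)) → EquitablyColorable L
  -- The varying cycle has to be the x side, so the two cycles are swapped here.
  orient fzero        = differing-lists L uniform (suc k) opposite opposite opposite-involutive
  orient (fsuc fzero) = differing-lists L uniform (suc k) id id (λ _ → refl)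

-- Dividing `n ∸ 4`, not `n`, by 3 keeps both parts of the glued ladder nonempty: `3 + q * 3`
-- columns and `suc r` columns.
aligned-colorable : ∀ {n} → 4 ≤ n → (L : ListAssignment n) → ∀ {ψ : Fin 2 → Fin 3 → ℕ} →
  Aligned ψ → (∀ b j i → ψ b j ∈ L (b , i)) → EquitablyColorable L
aligned-colorable {n} 4≤n L aligned ψ∈ with (n ∸ 4) / 3 | (n ∸ 4) % 3 | m%n<n (n ∸ 4) 3 | split
  where
  open ≡-Reasoning
  open +-*-Solver
  split : n ≡ 3 + (n ∸ 4) / 3 * 3 + suc ((n ∸ 4) % 3)
  split = begin
    n                                                ≡⟨ sym (m+[n∸m]≡n 4≤n) ⟩
    4 + (n ∸ 4)                                      ≡⟨ cong (4 +_) (m≡m%n+[m/n]*n (n ∸ 4) 3) ⟩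
    4 + ((n ∸ 4) % 3 + (n ∸ 4) / 3 * 3)              ≡⟨ solve 2 (λ x y → con 4 :+ (x :+ y) := con 3 :+ y :+ (con 1 :+ x))
                                                          refl ((n ∸ 4) % 3) ((n ∸ 4) / 3 * 3) ⟩
    3 + (n ∸ 4) / 3 * 3 + suc ((n ∸ 4) % 3)          ∎
... | q | r | r<3 | refl = stripe-colorable q r r<3 L aligned ψ∈

sublist-colorable : ∀ {n} → 4 ≤ n → (L : ListAssignment n) (S : Fin 2 → List ℕ) → (∀ b → Three (S b)) →
  (∀ b i {x} → x ∈ S b → x ∈ L (b , i)) → EquitablyColorable L
sublist-colorable 4≤n L S three S⊆L =
  color (align 3 S (λ b → proj₂ (three b)) (λ b → ≤-reflexive (sym (proj₁ (three b)))))
  where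
  color : (∃ λ (ψ : Fin 2 → Fin 3 → ℕ) → (∀ b k → ψ b k ∈ S b) × Aligned ψ) → EquitablyColorable L
  color (ψ , ψ∈ , aligned) = aligned-colorable 4≤n L aligned (λ b j i → S⊆L b i (ψ∈ b j))

three-uniform-colorable : ∀ {n} → 4 ≤ n → (L : ListAssignment n) → ThreeUniform L → EquitablyColorable L
three-uniform-colorable {n} 4≤n with n ∸ 4 | trans (sym (m∸n+n≡m 4≤n)) (+-suc (n ∸ 4) 3)
... | M | refl = colorable
  where
  colorable : (L : ListAssignment (suc M + 3)) → ThreeUniform L → EquitablyColorable L
  colorable L uniform =
    [ (λ (k , _ , γ∈ , γ∉) → escape-colorable L uniform fzero k γ∈ γ∉)
    , (λ sub₀ → [ (λ (k , _ , γ∈ , γ∉) → escape-colorable L uniform (fsuc fzero) k γ∈ γ∉)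
                , (λ sub₁ → nested (λ { fzero → sub₀ ; (fsuc fzero) → sub₁ }))
                ]′ (first-escape (along (fsuc fzero)) (suc M + 3)))
    ]′ (first-escape (along fzero) (suc M + 3))
    where
    along : Fin 2 → ℕ → List ℕ
    along b k = L (b , k mod (suc M + 3))
    nested : (∀ b k x → k ≤ suc M + 3 → x ∈ along b (suc M + 3) → x ∈ along b k) → EquitablyColorable L
    -- Column `suc M + 3` is column 0 again; without new colors along the cycle its list is
    -- contained in every other list.
    nested sub = sublist-colorable 4≤n L (λ b → along b (suc M + 3)) (λ b → uniform _)
      λ b i x∈ → subst (λ j → _ ∈ L (b , j)) (toℕ-mod i) (sub b _ _ (<⇒≤ (toℕ<n i)) x∈)

theorem4p10 : (n : ℕ) → 6 ≤ n → (L : ListAssignment n) → ThreeUniform L →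
    (c : Coloring n) → LexMin L c → Bounded (ceil3 (2 * n)) c
theorem4p10 n 6≤n L uniform c lexMin
  with three-uniform-colorable (≤-trans (m≤m+n 4 2) 6≤n) L uniform
... | c′ , proper , bounded = lexMin-bounded lexMin proper bounded
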